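{- Let $(G=(V,E),w,d)$ be an instance of the Bandwidth Multicoloring Problem and let $k$ be a positive integer (the target span). There exists a valid coloring $c: V\to\mathcal{P}(\mathbb{Z}^+)$ of $G$ with span $k$ if and only if the order-based propositional formula for $(G,w,d)$ and $k$ (defined in the context) is satisfiable.
   Context: A Bandwidth Multicoloring Problem (BMCP) instance consists of a finite nonempty undirected graph $G=(V,E)$, a vertex weight function $w: V\to\mathbb{Z}^+$ (number of colors required at each vertex), and an edge weight function $d: E\to\mathbb{Z}^+$. Here $E$ is regarded as containing a loop $\{u,u\}$ for every vertex $u\in V$, so that $d(\{u,u\})\in\mathbb{Z}^+$ is defined for every $u \in V$; it is the minimum separation between colors at the same vertex. A valid coloring is a map $c: V\to\mathcal{P}(\mathbb{Z}^+)$ such that: (1) $|c(u)|=w(u)$ for every $u\in V$; (2) for every $u\in V$, any two distinct colors $m,n\in c(u)$ satisfy $|m-n|\ge d(\{u,u\})$; (3) for every edge $\{u,v\}\in E$ with $u\neq v$, every $m\in c(u)$ and every $n\in c(v)$ satisfy $|m-n|\ge d(\{u,v\})$. The span of $c$ is $\max_{u\in V,\, m\in c(u)} m$. Order-based formula for target span $k$. All intervals are intervals of integers. For $u\in V$ and $i\in[1,w(u)]$ put $$LB_{u,i}=1+(i-1)\,d(\{u,u\}),\qquad UB_{u,i}=k-(w(u)-i)\,d(\{u,u\}).$$ The Boolean variables are $x_{u,i,m}$ and $g_{u,i,m}$ for $u\in V$, $i\in[1,w(u)]$, $m\in[LB_{u,i},UB_{u,i}]$. (Intended meaning: writing the colors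 of $u$ in increasing order $c(u)_1<\dots<c(u)_{w(u)}$, $x_{u,i,m}$ means $c(u)_i=m$, and $g_{u,i,m}$ means $c(u)_i\ge m$.) Convention for non-existent variables: when $LB_{u,i}\le UB_{u,i}$, the symbol $g_{u,i,m}$ denotes the constant true if $m<LB_{u,i}$ and the constant false if $m>UB_{u,i}$. If $LB_{u,i}>UB_{u,i}$ for some $u,i$, there are no variables for that pair, the symbol $g_{u,i,LB_{u,i}}$ in constraint (d) below is the constant false, and the whole formula is thus unsatisfiable. The formula is the conjunction of the following constraints: (a) Linkage: $x_{u,i,m}\leftrightarrow (g_{u,i,m}\wedge\neg g_{u,i,m+1})$ for all $u\in V$, $i\in[1,w(u)]$, $m\in[LB_{u,i},UB_{u,i}-1]$. (b) Linkage at the upper end: $x_{u,i,UB_{u,i}}\leftrightarrow g_{u,i,UB_{u,i}}$ for all $u\in V$, $i\in[1,w(u)]$. (c) Monotonicity: $g_{u,i,m}\rightarrow g_{u,i,m-1}$ for all $u\in V$, $i\in[1,w(u)]$, $m\in[LB_{u,i}+1,UB_{u,i}]$. (d) Lower bound: $g_{u,i,LB_{u,i}}$ for all $u\in V$, $i\in[1,w(u)]$. (e) Intra-vertex distance: $g_{u,i,m}\rightarrow g_{u,i+1,m+d(\{u,u\})}$ for all $u\in V$, $i\in[1,w(u)-1]$, $m\in[LB_{u,i},UB_{u,i}]$. (f) Inter-vertex distance: $x_{u,i,m}\rightarrow\bigl(g_{v,j,m+d(\{u,v\})}\vee\neg g_{v,j,m-d(\{u,v\})+1}\bigr)$ for all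 $u,v\in V$ with $u\ne v$ and $\{u,v\}\in E$, all $i\in[1,w(u)]$, $j\in[1,w(v)]$, $m\in[LB_{u,i},UB_{u,i}]$. -}

module Defs where

open import Data.Bool.Base using (Bool; true; false; not; _xor_)
  renaming (_∧_ to _and_; _∨_ to _or_)
open import Data.Fin.Base using (Fin; toℕ)
import Data.Fin.Properties as Fin
open import Data.Integer.Base using (ℤ; +_; 1ℤ; _+_; _-_; _*_; _≤_; _⊔_) renaming (∣_∣ to abs)
open import Data.Integer.Properties using (_<?_; ≮⇒≥; _≤?_)
open import Data.Irrelevant using ([_])
open import Data.List.Base using (List; length; foldr; applyUpTo; allFin)
open import Data.List.Membership.Propositional using (_∈_)
open import Data.List.Relation.Unary.Unique.Propositional using (Unique)
open import Data.Nat.Base as ℕ using (ℕ; suc; NonZero; ∣_-_∣)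
import Data.Nat.Properties as ℕ
open import Data.Product.Base using (∃-syntax; _×_; _,_)
open import Data.Refinement.Base using (Refinement-syntax; value) renaming (_,_ to _,ᵣ_)
open import Function.Bundles using (_⇔_)
open import Level using (0ℓ)
open import Relation.Binary.Core using (Rel)
open import Relation.Binary.Definitions using (Decidable; Reflexive; Symmetric)
open import Relation.Binary.PropositionalEquality.Core using (_≡_; _≢_)
open import Relation.Nullary.Decidable using (Dec; yes; no; ¬?; _×-dec_)
open import Relation.Unary using (Pred)

ℤ⁺ : Set
ℤ⁺ = [ n ∈ ℕ ∣ NonZero n ]

record BMCP : Set₁ where
  infix 4 _~_ _~?_
  field
    order : ℤ⁺

  V : Set
  V = Fin (value order)

  field
    _~_    : Rel V 0ℓ
    _~?_   : Decidable _~_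
    -- Every vertex carries a loop.
    ~-refl : Reflexive _~_
    ~-sym  : Symmetric _~_
    w      : V → ℤ⁺
    d      : ∀ {u v} → u ~ v → ℤ⁺
    -- d is a function of the unordered pair {u , v}; by ~-sym this also makes it
    -- independent of the proof of u ~ v.
    d-sym  : ∀ {u v} (e : u ~ v) (e′ : v ~ u) → d e ≡ d e′

HasCardinality : {A : Set} → Pred A 0ℓ → ℕ → Set
HasCardinality {A} P n =
  ∃[ xs ] Unique xs × length xs ≡ n × (∀ (a : A) → P a ⇔ a ∈ xs)

module _ (I : BMCP) where
  open BMCP I

  Colouring : Set₁
  Colouring = V → Pred ℤ⁺ 0ℓ

  record IsValid (c : Colouring) : Set where
    field
      cardinality : ∀ u → HasCardinality (c u) (value (w u))
      intra       : ∀ u {m n} → c u m → c u n → m ≢ n →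
                    ∣ value m - value n ∣ ℕ.≥ value (d (~-refl {u}))
      inter       : ∀ {u v} (e : u ~ v) → u ≢ v → ∀ {m n} → c u m → c v n →
                    ∣ value m - value n ∣ ℕ.≥ value (d e)

  -- k is the maximum of the set of all colours used by c.
  record HasSpan (c : Colouring) (k : ℤ⁺) : Set where
    field
      attained   : ∃[ u ] c u k
      upperBound : ∀ {u m} → c u m → value m ℕ.≤ value k

infix  9 ¬′_
infixr 7 _∧_
infixr 6 _∨_
infixr 5 _⇒_
infix  4 _⇔′_

data Formula (X : Set) : Set where
  var             : X → Formula X
  ⊤′ ⊥′           : Formula X
  ¬′_             : Formula X → Formula X
  _∧_ _∨_ _⇒_ _⇔′_ : Formula X → Formula X → Formula X

eval : {X : Set} → (X → Bool) → Formula X → Bool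
eval σ (var x)  = σ x
eval σ ⊤′       = true
eval σ ⊥′       = false
eval σ (¬′ φ)   = not (eval σ φ)
eval σ (φ ∧ ψ)  = eval σ φ and eval σ ψ
eval σ (φ ∨ ψ)  = eval σ φ or eval σ ψ
eval σ (φ ⇒ ψ)  = not (eval σ φ) or eval σ ψ
eval σ (φ ⇔′ ψ) = not (eval σ φ xor eval σ ψ)

Satisfiable : {X : Set} → Formula X → Set
Satisfiable {X} φ = ∃[ σ ] eval {X} σ φ ≡ true

⋀ : {A X : Set} → List A → (A → Formula X) → Formula X
⋀ xs φ = foldr (λ a ψ → φ a ∧ ψ) ⊤′ xs

-- The formula φ if the side condition P holds, and no constraint otherwise.
when : {P X : Set} → Dec P → (P → Formula X) → Formula X
when (yes p) φ = φ p
when (no _)  φ = ⊤′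

-- The integers a, a + 1, …, b; empty if b < a.
interval : ℤ → ℤ → List ℤ
interval a b = applyUpTo (λ j → a + + j) (abs (((b + 1ℤ) ⊔ a) - a))

module OrderBased (I : BMCP) (k : ℤ⁺) where
  open BMCP I

  Index : V → Set
  Index u = Fin (value (w u))

  indices : ∀ u → List (Index u)
  indices u = allFin (value (w u))

  vertices : List V
  vertices = allFin (value order)

  -- Fin counts from 0, whereas the colours of u are numbered 1, …, w(u).
  rank : ∀ {u} → Index u → ℤ
  rank i = + suc (toℕ i)

  dist : ∀ {u v} → u ~ v → ℤ
  dist e = + value (d e)

  loop : V → ℤ
  loop u = dist (~-refl {u})

  LB UB : ∀ u → Index u → ℤ
  LB u i = 1ℤ + (rank i - 1ℤ) * loop u
  UB u i = + value k - (+ value (w u) - rank i) * loop u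

  Range : ∀ u → Index u → Set
  Range u i = [ m ∈ ℤ ∣ LB u i ≤ m × m ≤ UB u i ]

  data Var : Set where
    x-var g-var : ∀ u (i : Index u) → Range u i → Var

  -- Out-of-range g follow the usual convention: true below LB, false above UB.
  -- If UB u i < LB u i, the order of the tests makes g u i (LB u i) false.
  g : ∀ u → Index u → ℤ → Formula Var
  g u i m with m <? LB u i | UB u i <? m
  ... | yes _   | _       = ⊤′
  ... | no _    | yes _   = ⊥′
  ... | no m≮LB | no UB≮m = var (g-var u i (m ,ᵣ [ ≮⇒≥ m≮LB , ≮⇒≥ UB≮m ]))

  -- The formula refers to an out-of-range x only in upperLinkage when
  -- UB u i < LB u i; lowerBound is then already false, so the value is immaterial.
  x : ∀ u → Index u → ℤ → Formula Var
  x u i m with LB u i ≤? m | m ≤? UB u i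
  ... | yes LB≤m | yes m≤UB = var (x-var u i (m ,ᵣ [ LB≤m , m≤UB ]))
  ... | _        | _        = ⊥′

  linkage upperLinkage monotonicity lowerBound intraDistance interDistance : Formula Var

  linkage =
    ⋀ vertices λ u → ⋀ (indices u) λ i → ⋀ (interval (LB u i) (UB u i - 1ℤ)) λ m →
      x u i m ⇔′ (g u i m ∧ ¬′ g u i (m + 1ℤ))

  upperLinkage =
    ⋀ vertices λ u → ⋀ (indices u) λ i →
      x u i (UB u i) ⇔′ g u i (UB u i)

  monotonicity =
    ⋀ vertices λ u → ⋀ (indices u) λ i → ⋀ (interval (LB u i + 1ℤ) (UB u i)) λ m →
      g u i m ⇒ g u i (m - 1ℤ)

  lowerBound =
    ⋀ vertices λ u → ⋀ (indices u) λ i →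
      g u i (LB u i)

  -- i⁺ plays the role of i + 1; no such index exists for i = w(u).
  intraDistance =
    ⋀ vertices λ u → ⋀ (indices u) λ i → ⋀ (indices u) λ i⁺ →
    when (toℕ i⁺ ℕ.≟ suc (toℕ i)) λ _ →
    ⋀ (interval (LB u i) (UB u i)) λ m →
      g u i m ⇒ g u i⁺ (m + loop u)

  interDistance =
    ⋀ vertices λ u → ⋀ vertices λ v →
    when (¬? (u Fin.≟ v) ×-dec (u ~? v)) λ (_ , e) →
    ⋀ (indices u) λ i → ⋀ (indices v) λ j → ⋀ (interval (LB u i) (UB u i)) λ m →
      x u i m ⇒ (g v j (m + dist e) ∨ ¬′ g v j (m - dist e + 1ℤ))

  formula : Formula Var
  formula =
    linkage ∧ upperLinkage ∧ monotonicity ∧ lowerBound ∧ intraDistance ∧ interDistance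

{-# OPTIONS --safe #-}

-- Both sides are equivalent to the existence of an arrangement: for every vertex an
-- increasing enumeration of its colours within [1, k], of which only consecutive gaps
-- need be controlled. An assignment and an arrangement s correspond to each other
-- through the rule that g u i m is true exactly when m ≤ s u i. An arrangement need
-- not use the colour k, but translating it upwards by the difference of k and its
-- largest colour preserves all separations and gives a colouring of span exactly k.
module Submission where

open import Defs
open import Data.Bool.Base using (Bool; true; false; T; not; _xor_)
  renaming (_∨_ to _or_)
open import Data.Bool.Properties using (T-≡; T-∧; T-∨; T?)
open import Data.Fin.Base using (Fin; zero; suc; toℕ; fromℕ; inject₁)
import Data.Fin.Properties as Fin
open import Data.Integer.Base
  using (ℤ; +_; -[1+_]; 1ℤ; _+_; _-_; -_; _*_; _≤_; _<_; _⊔_; +≤+) renaming (∣_∣ to abs)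
import Data.Integer.Properties as ℤ
open import Data.Integer.Properties using (_<?_)
open import Data.Integer.Tactic.RingSolver using (solve-∀)
open import Data.Irrelevant using ([_])
open import Data.List.Base using (List; _∷_; []; length; lookup; tabulate; allFin)
open import Data.List.Membership.Propositional using (_∈_)
open import Data.List.Membership.Propositional.Properties
  using (∈-lookup; ∈-allFin; ∈-applyUpTo⁺; ∈-tabulate⁺; ∈-tabulate⁻)
open import Data.List.Properties using (length-tabulate)
open import Data.List.Relation.Binary.Permutation.Propositional using (↭-sym; ↭⇒↭ₛ)
open import Data.List.Relation.Binary.Permutation.Propositional.Properties using (∈-resp-↭; ↭-length)
import Data.List.Relation.Binary.Permutation.Setoid.Properties as Permutationₛ
import Data.List.Relation.Unary.All as All
open import Data.List.Relation.Unary.Any using (here; there)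
open import Data.List.Relation.Unary.Sorted.TotalOrder.Properties using (lookup-mono-≤)
open import Data.List.Relation.Unary.Unique.Propositional using (Unique; _∷_)
open import Data.List.Relation.Unary.Unique.Propositional.Properties using (tabulate⁺)
import Data.List.Sort as Sort
open import Data.Nat.Base as ℕ using (ℕ; NonZero; ∣_-_∣)
import Data.Nat.Properties as ℕ
open import Data.List.Extrema ℕ.≤-totalOrder using (argmax; f[xs]≤f[argmax])
open import Data.Product.Base as Product using (∃-syntax; Σ-syntax; _×_; _,_; proj₁; proj₂)
open import Data.Refinement.Base using (value) renaming (_,_ to _,ᵣ_)
open import Data.Refinement.Properties using (value-injective)
open import Data.Sum.Base as Sum using (_⊎_; inj₁; inj₂)
open import Data.Unit.Base using (tt)
open import Function.Base using (_∘_; id)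
open import Function.Bundles using (_⇔_; mk⇔; Equivalence)
open import Level using (0ℓ)
open import Relation.Binary.Bundles using (DecTotalOrder)
import Relation.Binary.Construct.On as On
open import Relation.Binary.Definitions using (tri<; tri≈; tri>)
open import Relation.Binary.PropositionalEquality
  using (_≡_; _≢_; refl; sym; trans; cong; subst; subst₂; setoid; module ≡-Reasoning)
open import Relation.Nullary using (¬_; Dec; yes; no; contradiction; ⌊_⌋)
open import Relation.Nullary.Decidable using (toWitness; fromWitness; map′; decidable-stable; ¬?; _×-dec_)
open import Relation.Unary using (Pred)

open Equivalence using (to; from)

-- Positive integers

positive : (m : ℤ⁺) → 1 ℕ.≤ value m
positive (ℕ.suc _ ,ᵣ _)     = ℕ.s≤s ℕ.z≤n
positive (ℕ.zero  ,ᵣ [ () ])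

-- Serves twice: at `w u` it gives the index of the largest colour of `u`, and at `order` a vertex
-- from which a maximum over all vertices can start.
last : (n : ℤ⁺) → Σ[ i ∈ Fin (value n) ] (∀ (j : Fin (value n)) → toℕ j ℕ.≤ toℕ i)
last (ℕ.suc n ,ᵣ _)     = fromℕ n , Fin.≤fromℕ
last (ℕ.zero  ,ᵣ [ () ])

-- Spaced sequences of naturals

-- The distance condition without absolute values; its two cases match the two disjuncts in
-- `interDistance`.
Separated : ℕ → ℕ → ℕ → Set
Separated δ a b = a ℕ.+ δ ℕ.≤ b ⊎ b ℕ.+ δ ℕ.≤ a

m+δ≤n⇒δ≤∣m-n∣ : ∀ {δ} m {n} → m ℕ.+ δ ℕ.≤ n → δ ℕ.≤ ∣ m - n ∣
m+δ≤n⇒δ≤∣m-n∣ {δ} m {n} m+δ≤n = begin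
  δ            ≤⟨ ℕ.m+n≤o⇒m≤o∸n δ (subst (ℕ._≤ n) (ℕ.+-comm m δ) m+δ≤n) ⟩
  n ℕ.∸ m      ≡⟨ ℕ.m≤n⇒∣m-n∣≡n∸m (ℕ.m+n≤o⇒m≤o m m+δ≤n) ⟨
  ∣ m - n ∣    ∎
  where open ℕ.≤-Reasoning

δ≤∣m-n∣⇒m+δ≤n : ∀ {δ m n} → m ℕ.≤ n → δ ℕ.≤ ∣ m - n ∣ → m ℕ.+ δ ℕ.≤ n
δ≤∣m-n∣⇒m+δ≤n {δ} {m} {n} m≤n δ≤ = begin
  m ℕ.+ δ           ≤⟨ ℕ.+-monoʳ-≤ m δ≤ ⟩
  m ℕ.+ ∣ m - n ∣   ≡⟨ cong (m ℕ.+_) (ℕ.m≤n⇒∣m-n∣≡n∸m m≤n) ⟩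
  m ℕ.+ (n ℕ.∸ m)   ≡⟨ ℕ.m+[n∸m]≡n m≤n ⟩
  n                 ∎
  where open ℕ.≤-Reasoning

separated⇔ : ∀ {δ m n} → Separated δ m n ⇔ δ ℕ.≤ ∣ m - n ∣
separated⇔ {δ} {m} {n} = mk⇔ to′ from′
  where
  to′ : Separated δ m n → δ ℕ.≤ ∣ m - n ∣
  to′ (inj₁ m+δ≤n) = m+δ≤n⇒δ≤∣m-n∣ m m+δ≤n
  to′ (inj₂ n+δ≤m) = subst (δ ℕ.≤_) (ℕ.∣-∣-comm n m) (m+δ≤n⇒δ≤∣m-n∣ n n+δ≤m)

  from′ : δ ℕ.≤ ∣ m - n ∣ → Separated δ m n
  from′ δ≤ with ℕ.≤-total m n
  ... | inj₁ m≤n = inj₁ (δ≤∣m-n∣⇒m+δ≤n m≤n δ≤)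
  ... | inj₂ n≤m = inj₂ (δ≤∣m-n∣⇒m+δ≤n n≤m (subst (δ ℕ.≤_) (ℕ.∣-∣-comm m n) δ≤))

-- Successive indices are related by an equation between naturals, exactly the side condition of
-- `intraDistance`, so no successor operation on `Fin n` is involved.
Spaced : ∀ {n} → ℕ → (Fin n → ℕ) → Set
Spaced δ s = ∀ {i j} → toℕ j ≡ ℕ.suc (toℕ i) → s i ℕ.+ δ ℕ.≤ s j

-- Induction on the number `t` of gaps, removing the topmost one: `inject₁ j` is the predecessor of
-- `suc j` within the same `Fin`.
spaced-gap : ∀ {n δ} {s : Fin n → ℕ} → Spaced δ s →
             ∀ t {i j} → toℕ j ≡ t ℕ.+ toℕ i → s i ℕ.+ t ℕ.* δ ℕ.≤ s j
spaced-gap {s = s} sp ℕ.zero {i} {j} eq = ℕ.≤-reflexive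
  (trans (ℕ.+-identityʳ (s i)) (cong s (sym (Fin.toℕ-injective eq))))
spaced-gap {δ = δ} {s} sp (ℕ.suc t) {i} {suc j} eq = begin
  s i ℕ.+ (δ ℕ.+ t ℕ.* δ)       ≡⟨ cong (s i ℕ.+_) (ℕ.+-comm δ (t ℕ.* δ)) ⟩
  s i ℕ.+ (t ℕ.* δ ℕ.+ δ)       ≡⟨ ℕ.+-assoc (s i) (t ℕ.* δ) δ ⟨
  s i ℕ.+ t ℕ.* δ ℕ.+ δ         ≤⟨ ℕ.+-monoˡ-≤ δ (spaced-gap sp t (trans toℕ-j′ (ℕ.suc-injective eq))) ⟩
  s (inject₁ j) ℕ.+ δ           ≤⟨ sp (cong ℕ.suc (sym toℕ-j′)) ⟩
  s (suc j)                     ∎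
  where
  open ℕ.≤-Reasoning
  toℕ-j′ = Fin.toℕ-inject₁ j

spaced-< : ∀ {n δ} {s : Fin n → ℕ} → Spaced δ s →
           ∀ {i j} → toℕ i ℕ.< toℕ j → s i ℕ.+ δ ℕ.≤ s j
spaced-< {δ = δ} {s} sp {i} {j} i<j = begin
  s i ℕ.+ δ                ≤⟨ ℕ.+-monoʳ-≤ (s i) (ℕ.m≤n*m δ t) ⟩
  s i ℕ.+ t ℕ.* δ          ≤⟨ spaced-gap sp t (sym (ℕ.m∸n+n≡m (ℕ.<⇒≤ i<j))) ⟩
  s j                      ∎
  where
  open ℕ.≤-Reasoning
  t = toℕ j ℕ.∸ toℕ i
  -- As `t` is nonzero, a single `δ` is at most `t * δ`.
  instance _ = ℕ.>-nonZero (ℕ.m<n⇒0<n∸m i<j)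

spaced-≤ : ∀ {n δ} {s : Fin n → ℕ} → Spaced δ s →
           ∀ {i j} → toℕ i ℕ.≤ toℕ j → s i ℕ.≤ s j
spaced-≤ {δ = δ} {s} sp i≤j =
  ℕ.m+n≤o⇒m≤o (s _) (spaced-gap sp _ (sym (ℕ.m∸n+n≡m i≤j)))

spaced⇒separated : ∀ {n δ} {s : Fin n → ℕ} → Spaced δ s →
                   ∀ {i j} → i ≢ j → Separated δ (s i) (s j)
spaced⇒separated sp {i} {j} i≢j with ℕ.<-cmp (toℕ i) (toℕ j)
... | tri< i<j _ _ = inj₁ (spaced-< sp i<j)
... | tri≈ _ i≡j _ = contradiction (Fin.toℕ-injective i≡j) i≢j
... | tri> _ _ j<i = inj₂ (spaced-< sp j<i)

-- Comparison with index `zero`. With `a = 1` the left side is `LB`, because `toℕ i` is the rank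
-- minus one.
spaced-lower : ∀ {n δ a} {s : Fin n → ℕ} → (∀ i → a ℕ.≤ s i) → Spaced δ s →
               ∀ i → a ℕ.+ toℕ i ℕ.* δ ℕ.≤ s i
spaced-lower {ℕ.suc _} {δ} a≤s sp i = ℕ.≤-trans
  (ℕ.+-monoˡ-≤ (toℕ i ℕ.* δ) (a≤s zero))
  (spaced-gap sp (toℕ i) (sym (ℕ.+-identityʳ (toℕ i))))

-- Comparison with the last index, where `t` counts the indices after `i`. With `b = k` this is the
-- bound `UB`, put additively to avoid truncated subtraction.
spaced-upper : ∀ {n δ b} {s : Fin n → ℕ} → (∀ i → s i ℕ.≤ b) → Spaced δ s →
               ∀ t i → n ≡ t ℕ.+ ℕ.suc (toℕ i) → s i ℕ.+ t ℕ.* δ ℕ.≤ b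
spaced-upper {ℕ.suc n} s≤b sp t i eq = ℕ.≤-trans
  (spaced-gap sp t (trans (Fin.toℕ-fromℕ n) (ℕ.suc-injective (trans eq (ℕ.+-suc t (toℕ i))))))
  (s≤b (fromℕ n))

-- Enumerating a finite set of colours in increasing order

colourOrder : DecTotalOrder 0ℓ 0ℓ 0ℓ
colourOrder = On.decTotalOrder ℕ.≤-decTotalOrder (value {P = NonZero})

lookup-injective : {A : Set} {xs : List A} → Unique xs →
                   ∀ {i j} → lookup xs i ≡ lookup xs j → i ≡ j
lookup-injective (_ ∷ _)  {zero}  {zero}  _  = refl
lookup-injective (p ∷ _)  {zero}  {suc j} eq = contradiction eq (All.lookup p (∈-lookup j))
lookup-injective (p ∷ _)  {suc i} {zero}  eq = contradiction (sym eq) (All.lookup p (∈-lookup i))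
lookup-injective (_ ∷ us) {suc i} {suc j} eq = cong suc (lookup-injective us eq)

-- Sorting preserves membership and distinctness. Neighbours in the sorted list are thus distinct
-- members in increasing order, so the bound on their absolute difference becomes a bound on the
-- directed gap.
enumerate : ∀ {P : Pred ℤ⁺ 0ℓ} {n δ} → HasCardinality P n →
            (∀ {m n} → P m → P n → m ≢ n → ∣ value m - value n ∣ ℕ.≥ δ) →
            ∃[ s ] (∀ (i : Fin n) → P (s i)) × Spaced δ (value ∘ s)
enumerate {P} {_} {δ} (xs , unique , refl , P⇔∈xs) intra =
  -- Matching `refl` made `n` equal to `length xs`, whereas `lookup ys` is indexed by
  -- `Fin (length ys)`.
  subst (λ n → ∃[ s ] (∀ (i : Fin n) → P (s i)) × Spaced δ (value ∘ s))
        (↭-length ys↭xs) (lookup ys , P-lookup , spaced)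
  where
  open Sort colourOrder
  ys = sort xs
  ys↭xs = sort-↭ xs

  ys-unique : Unique ys
  ys-unique = Permutationₛ.Unique-resp-↭ (setoid ℤ⁺) (↭⇒↭ₛ (↭-sym ys↭xs)) unique

  P-lookup : ∀ i → P (lookup ys i)
  P-lookup i = from (P⇔∈xs _) (∈-resp-↭ ys↭xs (∈-lookup i))

  spaced : Spaced δ (value ∘ lookup ys)
  spaced {i} {j} j≡1+i = δ≤∣m-n∣⇒m+δ≤n
    (lookup-mono-≤ (DecTotalOrder.totalOrder colourOrder) (sort-↗ xs) (ℕ.<⇒≤ i<j))
    (intra (P-lookup i) (P-lookup j)
      (λ eq → ℕ.<⇒≢ i<j (cong toℕ (lookup-injective ys-unique eq))))
    where
    i<j : toℕ i ℕ.< toℕ j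
    i<j = ℕ.≤-reflexive (sym j≡1+i)

-- Arrangements

module _ (I : BMCP) where
  open BMCP I

  -- Only the crude bounds 1 and `k` are recorded; the sharper `LB` and `UB` follow from the
  -- spacing.
  record Arrangement (k : ℕ) : Set where
    field
      colour  : ∀ u → Fin (value (w u)) → ℕ
      ≥1      : ∀ u i → 1 ℕ.≤ colour u i
      ≤k      : ∀ u i → colour u i ℕ.≤ k
      spaced  : ∀ u → Spaced (value (d (~-refl {u}))) (colour u)
      inter   : ∀ {u v} (e : u ~ v) → u ≢ v → ∀ i j →
                Separated (value (d e)) (colour u i) (colour v j)

  colouring⇒arrangement : ∀ {c k} → IsValid I c → HasSpan I c k → Arrangement (value k)
  colouring⇒arrangement {c} valid span = record
    { colour = λ u → value ∘ proj₁ (enum u)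
    ; ≥1     = λ u i → positive (proj₁ (enum u) i)
    ; ≤k     = λ u i → HasSpan.upperBound span (proj₁ (proj₂ (enum u)) i)
    ; spaced = λ u → proj₂ (proj₂ (enum u))
    ; inter  = λ {u} {v} e u≢v i j → from separated⇔
        (IsValid.inter valid e u≢v (proj₁ (proj₂ (enum u)) i) (proj₁ (proj₂ (enum v)) j))
    }
    where
    enum = λ u → enumerate (IsValid.cardinality valid u) (IsValid.intra valid u)

  arrangement⇒colouring : ∀ {k} → Arrangement (value k) → ∃[ c ] IsValid I c × HasSpan I c k
  arrangement⇒colouring {k} A = c , valid , span
    where
    open Arrangement A

    top : V → ℕ
    top u = colour u (proj₁ (last (w u)))

    v₀ u₀ : V
    v₀ = proj₁ (last order)
    u₀ = argmax top v₀ (allFin _)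

    ≤top : ∀ u i → colour u i ℕ.≤ top u₀
    ≤top u i = ℕ.≤-trans (spaced-≤ (spaced u) (proj₂ (last (w u)) i))
      (All.lookup (f[xs]≤f[argmax] {f = top} v₀ (allFin _)) (∈-allFin u))

    -- The truncated subtraction is exact, since no colour exceeds `k`.
    shift : ℕ
    shift = value k ℕ.∸ top u₀

    shifted : ∀ u → Fin (value (w u)) → ℤ⁺
    shifted u i = shift ℕ.+ colour u i ,ᵣ [ ℕ.>-nonZero (ℕ.≤-trans (≥1 u i) (ℕ.m≤n+m _ shift)) ]

    c : Colouring I
    c u m = ∃[ i ] m ≡ shifted u i

    shift-separated : ∀ {δ a b} → Separated δ a b → δ ℕ.≤ ∣ shift ℕ.+ a - shift ℕ.+ b ∣
    shift-separated {δ} {a} {b} sep =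
      subst (δ ℕ.≤_) (sym (ℕ.∣m+n-m+o∣≡∣n-o∣ shift a b)) (to separated⇔ sep)

    -- Equal colours at different indices would be at distance 0, but the loop distance is positive.
    distinct : ∀ u {i j} → shifted u i ≡ shifted u j → i ≡ j
    distinct u {i} {j} eq = decidable-stable (i Fin.≟ j) λ i≢j → ℕ.<⇒≱ (positive (d ~-refl))
      (ℕ.≤-trans (to separated⇔ (spaced⇒separated (spaced u) i≢j))
        (ℕ.≤-reflexive (ℕ.m≡n⇒∣m-n∣≡0 (ℕ.+-cancelˡ-≡ shift _ _ (cong value eq)))))

    valid : IsValid I c
    valid = record
      { cardinality = λ u → tabulate (shifted u) , tabulate⁺ (distinct u) , length-tabulate (shifted u) ,
          λ m → mk⇔ (λ { (i , refl) → ∈-tabulate⁺ i }) ∈-tabulate⁻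
      ; intra = λ { u (i , refl) (j , refl) m≢n →
          shift-separated (spaced⇒separated (spaced u) (m≢n ∘ cong (shifted u))) }
      ; inter = λ { e u≢v (i , refl) (j , refl) → shift-separated (inter e u≢v i j) }
      }

    shift+top : shift ℕ.+ top u₀ ≡ value k
    shift+top = ℕ.m∸n+n≡m (≤k u₀ _)

    span : HasSpan I c k
    span = record
      { attained   = u₀ , _ , value-injective (sym shift+top)
      ; upperBound = λ { {u} (i , refl) →
          ℕ.≤-trans (ℕ.+-monoʳ-≤ shift (≤top u i)) (ℕ.≤-reflexive shift+top) }
      }

-- Truth of formulas

T-¬ : ∀ {x} → T (not x) ⇔ (¬ T x)
T-¬ {true}  = mk⇔ (λ ()) (λ ¬t → ¬t tt)
T-¬ {false} = mk⇔ (λ _ ()) (λ _ → tt)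

T-⇒ : ∀ {x y} → T (not x or y) ⇔ (T x → T y)
T-⇒ {true}  = mk⇔ (λ t _ → t) (λ f → f tt)
T-⇒ {false} = mk⇔ (λ _ ()) (λ _ → tt)

T-⇔ : ∀ {x y} → T (not (x xor y)) ⇔ (T x ⇔ T y)
T-⇔ {true}  {true}  = mk⇔ (λ _ → mk⇔ id id) (λ _ → tt)
T-⇔ {true}  {false} = mk⇔ (λ ()) (λ e → to e tt)
T-⇔ {false} {true}  = mk⇔ (λ ()) (λ e → from e tt)
T-⇔ {false} {false} = mk⇔ (λ _ → mk⇔ id id) (λ _ → tt)

infix 3 _⊨_

-- A record, so that the assignment and the formula can be inferred.
record _⊨_ {X : Set} (σ : X → Bool) (φ : Formula X) : Set where
  constructor holds
  field truth : T (eval σ φ)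

open _⊨_

module _ {X : Set} {σ : X → Bool} where

  ⊨? : (φ : Formula X) → Dec (σ ⊨ φ)
  ⊨? φ = map′ holds truth (T? (eval σ φ))

  ⊨⊤ : σ ⊨ ⊤′
  ⊨⊤ = holds tt

  ⊭⊥ : ¬ (σ ⊨ ⊥′)
  ⊭⊥ (holds ())

  ⊨¬ : ∀ {φ} → (σ ⊨ ¬′ φ) ⇔ (¬ (σ ⊨ φ))
  ⊨¬ = mk⇔ (λ p → to T-¬ (truth p) ∘ truth) (λ f → holds (from T-¬ (f ∘ holds)))

  ⊨∧ : ∀ {φ ψ} → (σ ⊨ φ ∧ ψ) ⇔ ((σ ⊨ φ) × (σ ⊨ ψ))
  ⊨∧ = mk⇔ (λ p → Product.map holds holds (to T-∧ (truth p)))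
           (λ (p , q) → holds (from T-∧ (truth p , truth q)))

  ⊨∨ : ∀ {φ ψ} → (σ ⊨ φ ∨ ψ) ⇔ ((σ ⊨ φ) ⊎ (σ ⊨ ψ))
  ⊨∨ = mk⇔ (λ p → Sum.map holds holds (to T-∨ (truth p)))
           (λ p → holds (from T-∨ (Sum.map truth truth p)))

  ⊨⇒ : ∀ {φ ψ} → (σ ⊨ φ ⇒ ψ) ⇔ (σ ⊨ φ → σ ⊨ ψ)
  ⊨⇒ = mk⇔ (λ p → holds ∘ to T-⇒ (truth p) ∘ truth)
           (λ f → holds (from T-⇒ (truth ∘ f ∘ holds)))

  ⊨⇔ : ∀ {φ ψ} → (σ ⊨ φ ⇔′ ψ) ⇔ ((σ ⊨ φ) ⇔ (σ ⊨ ψ))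
  ⊨⇔ = mk⇔ (λ p → let e = to T-⇔ (truth p) in mk⇔ (holds ∘ to e ∘ truth) (holds ∘ from e ∘ truth))
           (λ e → holds (from T-⇔ (mk⇔ (truth ∘ to e ∘ holds) (truth ∘ from e ∘ holds))))

  ⊨⋀⁺ : {A : Set} {φ : A → Formula X} (xs : List A) → (∀ a → σ ⊨ φ a) → σ ⊨ ⋀ xs φ
  ⊨⋀⁺ []       _ = ⊨⊤
  ⊨⋀⁺ (a ∷ xs) p = from ⊨∧ (p a , ⊨⋀⁺ xs p)

  ⊨⋀⁻ : {A : Set} {φ : A → Formula X} {xs : List A} → σ ⊨ ⋀ xs φ → ∀ {a} → a ∈ xs → σ ⊨ φ a
  ⊨⋀⁻ {xs = _ ∷ _} p (here refl) = proj₁ (to ⊨∧ p)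
  ⊨⋀⁻ {xs = _ ∷ _} p (there a∈)  = ⊨⋀⁻ (proj₂ (to ⊨∧ p)) a∈

  ⊨when⁺ : {P : Set} {φ : P → Formula X} (P? : Dec P) → (∀ p → σ ⊨ φ p) → σ ⊨ when P? φ
  ⊨when⁺ (yes p) h = h p
  ⊨when⁺ (no _)  _ = ⊨⊤

  -- The body is instantiated at the proof stored in `P?`, which may differ from the one supplied,
  -- so the stored proof is returned.
  ⊨when⁻ : {P : Set} {φ : P → Formula X} (P? : Dec P) → σ ⊨ when P? φ → P → ∃[ p ] (σ ⊨ φ p)
  ⊨when⁻ (yes p) h _ = p , h
  ⊨when⁻ (no ¬p) _ p = contradiction p ¬p

-- Integers and intervals

-- Supplies a natural number on which to recurse when moving between two integers.
≤⇒∃+ : ∀ {a b} → a ≤ b → ∃[ n ] b ≡ a + + n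
≤⇒∃+ {a} {b} a≤b = abs (b - a) , (begin
  b                  ≡⟨ rearrange a b ⟩
  a + (b - a)        ≡⟨ cong (λ z → a + z) (ℤ.0≤i⇒+∣i∣≡i (ℤ.i≤j⇒0≤j-i a≤b)) ⟨
  a + + abs (b - a)  ∎)
  where
  open ≡-Reasoning
  rearrange : ∀ a b → b ≡ a + (b - a)
  rearrange = solve-∀

i<i+1 : ∀ i → i < i + 1ℤ
i<i+1 i = subst (i <_) (ℤ.+-comm 1ℤ i) (ℤ.suc[i]≤j⇒i<j ℤ.≤-refl)

i<j⇒i+1≤j : ∀ {i j} → i < j → i + 1ℤ ≤ j
i<j⇒i+1≤j {i} {j} i<j = subst (_≤ j) (ℤ.+-comm 1ℤ i) (ℤ.i<j⇒suc[i]≤j i<j)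

i+1≤j⇒i<j : ∀ {i j} → i + 1ℤ ≤ j → i < j
i+1≤j⇒i<j {i} = ℤ.<-≤-trans (i<i+1 i)

i+j-j≡i : ∀ i j → i + j - j ≡ i
i+j-j≡i = solve-∀

i-j+j≡i : ∀ i j → i - j + j ≡ i
i-j+j≡i = solve-∀

∈-interval : ∀ {a b m} → a ≤ m → m ≤ b → m ∈ interval a b
∈-interval {a} {b} {m} a≤m m≤b with n , refl ← ≤⇒∃+ a≤m =
  ∈-applyUpTo⁺ (λ j → a + + j) (ℤ.drop‿+<+ (begin-strict
    + n                        ≡⟨ rearrange a (+ n) ⟨
    a + + n - a                <⟨ ℤ.+-monoˡ-< (- a) (ℤ.≤-<-trans m≤b (i<i+1 b)) ⟩
    b + 1ℤ - a                 ≤⟨ ℤ.+-monoˡ-≤ (- a) (ℤ.i≤i⊔j (b + 1ℤ) a) ⟩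
    (b + 1ℤ) ⊔ a - a           ≡⟨ ℤ.0≤i⇒+∣i∣≡i (ℤ.i≤j⇒0≤j-i (ℤ.i≤j⊔i (b + 1ℤ) a)) ⟨
    + abs ((b + 1ℤ) ⊔ a - a)   ∎))
  where
  open ℤ.≤-Reasoning
  rearrange : ∀ a n → a + n - a ≡ n
  rearrange = solve-∀

-- Scans upwards from `a` and stops at the first point whose successor fails, which happens within
-- `n` steps. Without monotonicity this is merely one place where `p` switches from true to false.
lastTrue : {p : ℤ → Set} → (∀ m → Dec (p m)) → ∀ n {a} → p a → ¬ p (a + + n) →
           ∃[ m ] a ≤ m × p m × ¬ p (m + 1ℤ)
lastTrue {p} p? ℕ.zero {a} pa ¬pa+n = contradiction (subst p (sym (ℤ.+-identityʳ a)) pa) ¬pa+n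
lastTrue {p} p? (ℕ.suc n) {a} pa ¬pa+n with p? (a + 1ℤ)
... | no ¬pa+1 = a , ℤ.≤-refl , pa , ¬pa+1
... | yes pa+1
  with m , a+1≤m , pm , ¬pm+1 ← lastTrue p? n pa+1 (¬pa+n ∘ subst p (ℤ.+-assoc a 1ℤ (+ n))) =
  m , ℤ.≤-trans (ℤ.<⇒≤ (i<i+1 a)) a+1≤m , pm , ¬pm+1

antitone : {p : ℤ → Set} → (∀ m → p m → p (m - 1ℤ)) → ∀ {m n} → m ≤ n → p n → p m
antitone {p} step {m} m≤n with n , refl ← ≤⇒∃+ m≤n = go n
  where
  rearrange : ∀ m n → m + (1ℤ + n) - 1ℤ ≡ m + n
  rearrange = solve-∀

  go : ∀ n → p (m + + n) → p m
  go ℕ.zero    pm = subst p (ℤ.+-identityʳ m) pm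
  go (ℕ.suc n) pm = go n (subst p (rearrange m (+ n)) (step _ pm))

-- Decodes the negated disjunct of `interDistance`, whose `+ 1ℤ` turns a strict inequality into a
-- weak one.
i<j-k+1⇒i+k≤j : ∀ {i j} k → i < j - k + 1ℤ → i + k ≤ j
i<j-k+1⇒i+k≤j {i} {j} k i<j-k+1 = subst₂ _≤_ (lhs i k) (rhs j k)
  (ℤ.+-monoˡ-≤ (k - 1ℤ) (i<j⇒i+1≤j i<j-k+1))
  where
  lhs : ∀ i k → i + 1ℤ + (k - 1ℤ) ≡ i + k
  lhs = solve-∀
  rhs : ∀ j k → j - k + 1ℤ + (k - 1ℤ) ≡ j
  rhs = solve-∀

i-k+1≤j⇒i<j+k : ∀ {i j} k → i - k + 1ℤ ≤ j → i < j + k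
i-k+1≤j⇒i<j+k {i} {j} k i-k+1≤j =
  subst (_< j + k) (i-j+j≡i i k) (ℤ.+-monoˡ-< k (i+1≤j⇒i<j {i - k} i-k+1≤j))

i≤j⇒i-1<j : ∀ {i j} → i ≤ j → i - 1ℤ < j
i≤j⇒i-1<j {i} {j} i≤j = ℤ.<-≤-trans (i+1≤j⇒i<j (ℤ.≤-reflexive (i-j+j≡i i 1ℤ))) i≤j

-- The bounds `LB` and `UB`, and the truth of `g` outside its range

module _ (I : BMCP) (k : ℤ⁺) where
  open BMCP I
  open OrderBased I k

  δ : V → ℕ
  δ u = value (d (~-refl {u}))

  -- `rank i - 1ℤ` computes to `+ toℕ i`, so only the product has to be moved into the naturals. The
  -- result shows that `LB` is positive.
  LB≡ : ∀ u i → LB u i ≡ + (1 ℕ.+ toℕ i ℕ.* δ u)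
  LB≡ u i = cong (λ z → 1ℤ + z) (sym (ℤ.pos-* (toℕ i) (δ u)))

  -- Here `t` is the number of indices after `i`. The outer subtraction stays in the integers
  -- because `UB` can be negative for small `k`.
  UB≡ : ∀ u i t → value (w u) ≡ t ℕ.+ ℕ.suc (toℕ i) → UB u i ≡ + value k - + (t ℕ.* δ u)
  UB≡ u i t eq = cong (λ z → + value k - z) (begin
    (+ value (w u) - rank i) * loop u           ≡⟨ cong (λ n → (+ n - rank i) * loop u) eq ⟩
    (+ t + rank i - rank i) * loop u            ≡⟨ cong (_* loop u) (i+j-j≡i (+ t) (rank i)) ⟩
    + t * loop u                                ≡⟨ ℤ.pos-* t (δ u) ⟨
    + (t ℕ.* δ u)                               ∎)
    where open ≡-Reasoning

  UB≤k : ∀ u i → UB u i ≤ + value k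
  UB≤k u i = subst (_≤ + value k) (sym (UB≡ u i _ (sym (ℕ.m∸n+n≡m (Fin.toℕ<n i)))))
    (ℤ.i-j≤i (+ value k) (+ ((value (w u) ℕ.∸ ℕ.suc (toℕ i)) ℕ.* δ u)))

  module _ {σ : Var → Bool} where

    ⊨g-below : ∀ {u i m} → m < LB u i → σ ⊨ g u i m
    ⊨g-below {u} {i} {m} m<LB with m <? LB u i | UB u i <? m
    ... | yes _   | _ = ⊨⊤
    ... | no m≮LB | _ = contradiction m<LB m≮LB

    ⊭g-above : ∀ {u i m} → LB u i ≤ m → UB u i < m → ¬ (σ ⊨ g u i m)
    ⊭g-above {u} {i} {m} LB≤m UB<m with m <? LB u i | UB u i <? m
    ... | yes m<LB | _        = contradiction LB≤m (ℤ.<⇒≱ m<LB)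
    ... | no _     | yes _    = ⊭⊥
    ... | no _     | no UB≮m  = contradiction UB<m UB≮m

  -- From a satisfying assignment to an arrangement

  module _ {σ : Var → Bool} (sat : σ ⊨ formula) where

    ⊨linkage = proj₁ (to ⊨∧ sat)
    sat₂ = proj₂ (to ⊨∧ sat)
    ⊨upperLinkage = proj₁ (to ⊨∧ sat₂)
    sat₃ = proj₂ (to ⊨∧ sat₂)
    ⊨monotonicity = proj₁ (to ⊨∧ sat₃)
    sat₄ = proj₂ (to ⊨∧ sat₃)
    ⊨lowerBound = proj₁ (to ⊨∧ sat₄)
    sat₅ = proj₂ (to ⊨∧ sat₄)
    ⊨intraDistance = proj₁ (to ⊨∧ sat₅)
    ⊨interDistance = proj₂ (to ⊨∧ sat₅)

    ⊨g-LB : ∀ u i → σ ⊨ g u i (LB u i)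
    ⊨g-LB u i = ⊨⋀⁻ (⊨⋀⁻ ⊨lowerBound (∈-allFin u)) (∈-allFin i)

    -- At `m = LB u i`, together with `lowerBound`, this rules out an empty range.
    ⊨g⇒≤UB : ∀ {u i m} → LB u i ≤ m → σ ⊨ g u i m → m ≤ UB u i
    ⊨g⇒≤UB LB≤m gm = ℤ.≮⇒≥ (λ UB<m → ⊭g-above LB≤m UB<m gm)

    -- Extends `monotonicity` to all integers: for `m` at most `LB` the conclusion is the constant
    -- true, and above `UB` the premise fails.
    ⊨g-pred : ∀ u i m → σ ⊨ g u i m → σ ⊨ g u i (m - 1ℤ)
    ⊨g-pred u i m gm with LB u i <? m
    ... | no  LB≮m = ⊨g-below (i≤j⇒i-1<j (ℤ.≮⇒≥ LB≮m))
    ... | yes LB<m = to ⊨⇒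
      (⊨⋀⁻ (⊨⋀⁻ (⊨⋀⁻ ⊨monotonicity (∈-allFin u)) (∈-allFin i))
        (∈-interval (i<j⇒i+1≤j LB<m) (⊨g⇒≤UB (ℤ.<⇒≤ LB<m) gm)))
      gm

    x⇔g∧¬g+1 : ∀ u i m → LB u i ≤ m → m < UB u i →
               (σ ⊨ x u i m) ⇔ (σ ⊨ g u i m ∧ ¬′ g u i (m + 1ℤ))
    x⇔g∧¬g+1 u i m LB≤m m<UB = to ⊨⇔
      (⊨⋀⁻ (⊨⋀⁻ (⊨⋀⁻ ⊨linkage (∈-allFin u)) (∈-allFin i)) (∈-interval LB≤m m≤UB-1))
      where
      m≤UB-1 : m ≤ UB u i - 1ℤ
      m≤UB-1 = subst (_≤ UB u i - 1ℤ) (i+j-j≡i m 1ℤ) (ℤ.+-monoˡ-≤ (- 1ℤ) (i<j⇒i+1≤j m<UB))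

    x⇔g-UB : ∀ u i → (σ ⊨ x u i (UB u i)) ⇔ (σ ⊨ g u i (UB u i))
    x⇔g-UB u i = to ⊨⇔ (⊨⋀⁻ (⊨⋀⁻ ⊨upperLinkage (∈-allFin u)) (∈-allFin i))

    g⇒g⁺ : ∀ u i i⁺ → toℕ i⁺ ≡ ℕ.suc (toℕ i) → ∀ m → LB u i ≤ m → m ≤ UB u i →
           σ ⊨ g u i m → σ ⊨ g u i⁺ (m + loop u)
    g⇒g⁺ u i i⁺ i⁺≡1+i m LB≤m m≤UB = to ⊨⇒ (⊨⋀⁻
      (proj₂ (⊨when⁻ (toℕ i⁺ ℕ.≟ ℕ.suc (toℕ i))
        (⊨⋀⁻ (⊨⋀⁻ (⊨⋀⁻ ⊨intraDistance (∈-allFin u)) (∈-allFin i)) (∈-allFin i⁺)) i⁺≡1+i))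
      (∈-interval LB≤m m≤UB))

    x⇒g∨¬g : ∀ {u v} (e : u ~ v) → u ≢ v → ∀ i j m → LB u i ≤ m → m ≤ UB u i →
             σ ⊨ x u i m → (σ ⊨ g v j (m + dist e)) ⊎ (¬ (σ ⊨ g v j (m - dist e + 1ℤ)))
    x⇒g∨¬g {u} {v} e u≢v i j m LB≤m m≤UB xm
      with (_ , e′) , p ← ⊨when⁻ (¬? (u Fin.≟ v) ×-dec (u ~? v))
             (⊨⋀⁻ (⊨⋀⁻ ⊨interDistance (∈-allFin u)) (∈-allFin v)) (u≢v , e) =
      -- The constraint mentions the edge proof `e′` found by `~?`. Passing through the reversed
      -- edge, `d-sym` identifies its distance with that of `e`.
      subst (λ n → (σ ⊨ g v j (m + + value n)) ⊎ (¬ (σ ⊨ g v j (m - + value n + 1ℤ))))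
        (trans (d-sym e′ (~-sym e)) (sym (d-sym e (~-sym e))))
        (Sum.map id (to ⊨¬) (to ⊨∨ (to ⊨⇒
          (⊨⋀⁻ (⊨⋀⁻ (⊨⋀⁻ p (∈-allFin i)) (∈-allFin j)) (∈-interval LB≤m m≤UB)) xm)))

    -- The decoded colour: `g` holds at `LB` by `lowerBound` and is constantly false at `UB + 1`, so
    -- it switches somewhere between.
    threshold : ∀ u i → ∃[ n ] LB u i ≤ + n × σ ⊨ g u i (+ n) × ¬ (σ ⊨ g u i (+ n + 1ℤ))
    threshold u i
      with n , UB+1≡ ← ≤⇒∃+ (ℤ.≤-trans (⊨g⇒≤UB ℤ.≤-refl (⊨g-LB u i)) (ℤ.<⇒≤ (i<i+1 (UB u i))))
      with lastTrue (λ m → ⊨? (g u i m)) n (⊨g-LB u i)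
             (subst (λ m → ¬ (σ ⊨ g u i m)) UB+1≡
               (⊭g-above (subst (LB u i ≤_) (sym UB+1≡) (ℤ.i≤i+j (LB u i) (+ n))) (i<i+1 (UB u i))))
    ... | + m , LB≤m , gm , ¬gm+1 = m , LB≤m , gm , ¬gm+1
    -- A negative switching point is impossible, as it would lie below the positive number `LB`.
    ... | -[1+ _ ] , LB≤m , _ = contradiction (subst (_≤ _) (LB≡ u i) LB≤m) λ ()

    level : ∀ u → Index u → ℕ
    level u i = proj₁ (threshold u i)

    s : ∀ u → Index u → ℤ
    s u i = + level u i

    LB≤s : ∀ u i → LB u i ≤ s u i
    LB≤s u i = proj₁ (proj₂ (threshold u i))

    ⊨g-s : ∀ u i → σ ⊨ g u i (s u i)
    ⊨g-s u i = proj₁ (proj₂ (proj₂ (threshold u i)))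

    ⊭g-s+1 : ∀ u i → ¬ (σ ⊨ g u i (s u i + 1ℤ))
    ⊭g-s+1 u i = proj₂ (proj₂ (proj₂ (threshold u i)))

    s≤UB : ∀ u i → s u i ≤ UB u i
    s≤UB u i = ⊨g⇒≤UB (LB≤s u i) (⊨g-s u i)

    -- Since `g` is antitone in `m`, its switching point determines it entirely; each `g` can now be
    -- read as a comparison with `s`.
    ⊨g⇔≤s : ∀ {u i m} → (σ ⊨ g u i m) ⇔ m ≤ s u i
    ⊨g⇔≤s {u} {i} {m} = mk⇔
      (λ gm → ℤ.≮⇒≥ (λ s<m → ⊭g-s+1 u i (antitone (⊨g-pred u i) (i<j⇒i+1≤j s<m) gm)))
      (λ m≤s → antitone (⊨g-pred u i) m≤s (⊨g-s u i))

    -- Below `UB` this comes from `linkage`, which stops at `UB - 1`; at `UB` itself `upperLinkage`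
    -- takes over.
    ⊨x-s : ∀ u i → σ ⊨ x u i (s u i)
    ⊨x-s u i = by-cases (s u i <? UB u i)
      where
      by-cases : Dec (s u i < UB u i) → σ ⊨ x u i (s u i)
      by-cases (yes s<UB) = from (x⇔g∧¬g+1 u i (s u i) (LB≤s u i) s<UB)
        (from ⊨∧ (⊨g-s u i , from ⊨¬ (⊭g-s+1 u i)))
      by-cases (no s≮UB) = subst (λ m → σ ⊨ x u i m) (sym s≡UB)
        (from (x⇔g-UB u i) (subst (λ m → σ ⊨ g u i m) s≡UB (⊨g-s u i)))
        where
        s≡UB : s u i ≡ UB u i
        s≡UB = ℤ.≤-antisym (s≤UB u i) (ℤ.≮⇒≥ s≮UB)

    satisfied⇒arrangement : Arrangement I (value k)
    satisfied⇒arrangement = record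
      { colour = level
      ; ≥1     = λ u i → ℕ.≤-trans (ℕ.m≤m+n 1 _)
          (ℤ.drop‿+≤+ (subst (_≤ s u i) (LB≡ u i) (LB≤s u i)))
      ; ≤k     = λ u i → ℤ.drop‿+≤+ (ℤ.≤-trans (s≤UB u i) (UB≤k u i))
      ; spaced = spaced
      ; inter  = inter
      }
      where
      spaced : ∀ u → Spaced (δ u) (level u)
      spaced u {i} {i⁺} i⁺≡1+i = ℤ.drop‿+≤+ (to ⊨g⇔≤s
        (g⇒g⁺ u i i⁺ i⁺≡1+i (s u i) (LB≤s u i) (s≤UB u i) (⊨g-s u i)))

      inter : ∀ {u v} (e : u ~ v) → u ≢ v → ∀ i j →
              Separated (value (d e)) (level u i) (level v j)
      -- The constraint is used at `m = s u i`, where `x` holds; its disjuncts place the colour of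
      -- `v` above or below that of `u`.
      inter {u} {v} e u≢v i j = Sum.map
        (λ above → ℤ.drop‿+≤+ (to ⊨g⇔≤s above))
        (λ ¬below → ℤ.drop‿+≤+ (i<j-k+1⇒i+k≤j (+ value (d e)) (ℤ.≰⇒> (¬below ∘ from ⊨g⇔≤s))))
        (x⇒g∨¬g e u≢v i j (s u i) (LB≤s u i) (s≤UB u i) (⊨x-s u i))

  -- From an arrangement to a satisfying assignment

  module _ (A : Arrangement I (value k)) where
    open Arrangement A

    LB≤colour : ∀ u i → LB u i ≤ + colour u i
    LB≤colour u i = subst (_≤ + colour u i) (sym (LB≡ u i)) (+≤+ (spaced-lower (≥1 u) (spaced u) i))

    colour≤UB : ∀ u i → + colour u i ≤ UB u i
    colour≤UB u i = begin
      + colour u i                                  ≡⟨ i+j-j≡i (+ colour u i) (+ (t ℕ.* δ u)) ⟨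
      + (colour u i ℕ.+ t ℕ.* δ u) - + (t ℕ.* δ u)  ≤⟨ ℤ.+-monoˡ-≤ (- + (t ℕ.* δ u))
                                                        (+≤+ (spaced-upper (≤k u) (spaced u) t i w≡)) ⟩
      + value k - + (t ℕ.* δ u)                     ≡⟨ UB≡ u i t w≡ ⟨
      UB u i                                        ∎
      where
      open ℤ.≤-Reasoning
      t = value (w u) ℕ.∸ ℕ.suc (toℕ i)
      w≡ : value (w u) ≡ t ℕ.+ ℕ.suc (toℕ i)
      w≡ = sym (ℕ.m∸n+n≡m (Fin.toℕ<n i))

    assignment : Var → Bool
    assignment (x-var u i m) = ⌊ value m ℤ.≟ + colour u i ⌋
    assignment (g-var u i m) = ⌊ value m ℤ.≤? + colour u i ⌋

    -- Reading an out-of-range `x` as false is correct because the colour lies between `LB` and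
    -- `UB`.
    ⊨x⇔≡ : ∀ {u i m} → (assignment ⊨ x u i m) ⇔ m ≡ + colour u i
    ⊨x⇔≡ {u} {i} {m} with LB u i ℤ.≤? m | m ℤ.≤? UB u i
    ... | yes _ | yes _ = mk⇔ (toWitness ∘ truth) (holds ∘ fromWitness)
    ... | yes _ | no m≰UB = mk⇔ (λ p → contradiction p ⊭⊥)
      (λ { refl → contradiction (colour≤UB u i) m≰UB })
    ... | no LB≰m | _ = mk⇔ (λ p → contradiction p ⊭⊥)
      (λ { refl → contradiction (LB≤colour u i) LB≰m })

    -- The constants outside the range agree with the comparison because the colour is at least `LB`
    -- and at most `UB`. Every constraint thereby becomes an inequality between colours.
    ⊨g⇔≤ : ∀ {u i m} → (assignment ⊨ g u i m) ⇔ m ≤ + colour u i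
    ⊨g⇔≤ {u} {i} {m} with m <? LB u i | UB u i <? m
    ... | yes m<LB | _ = mk⇔ (λ _ → ℤ.≤-trans (ℤ.<⇒≤ m<LB) (LB≤colour u i)) (λ _ → ⊨⊤)
    ... | no _ | yes UB<m = mk⇔ (λ p → contradiction p ⊭⊥)
      (λ m≤s → contradiction (ℤ.≤-trans m≤s (colour≤UB u i)) (ℤ.<⇒≱ UB<m))
    ... | no _ | no _ = mk⇔ (toWitness ∘ truth) (holds ∘ fromWitness)

    arrangement⇒satisfied : assignment ⊨ formula
    arrangement⇒satisfied = from ⊨∧
      ( (⊨⋀⁺ vertices λ u → ⊨⋀⁺ (indices u) λ i → ⊨⋀⁺ (interval (LB u i) (UB u i - 1ℤ)) λ m →
          from ⊨⇔ (mk⇔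
            (λ xm → let m≡s = to ⊨x⇔≡ xm in from ⊨∧
              ( from ⊨g⇔≤ (ℤ.≤-reflexive m≡s)
              , from ⊨¬ (λ gm+1 → ℤ.<-irrefl m≡s (i+1≤j⇒i<j (to ⊨g⇔≤ gm+1)))))
            (λ p → let gm , ¬gm+1 = to ⊨∧ p in from ⊨x⇔≡ (ℤ.≤-antisym (to ⊨g⇔≤ gm)
              (ℤ.≮⇒≥ (to ⊨¬ ¬gm+1 ∘ from ⊨g⇔≤ ∘ i<j⇒i+1≤j))))))
      , from ⊨∧
      ( (⊨⋀⁺ vertices λ u → ⊨⋀⁺ (indices u) λ i →
          from ⊨⇔ (mk⇔
            (λ xm → from ⊨g⇔≤ (ℤ.≤-reflexive (to ⊨x⇔≡ xm)))
            -- `g` at `UB` forces equality, since the colour cannot exceed `UB`.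
            (λ gm → from ⊨x⇔≡ (ℤ.≤-antisym (to ⊨g⇔≤ gm) (colour≤UB u i)))))
      , from ⊨∧
      ( (⊨⋀⁺ vertices λ u → ⊨⋀⁺ (indices u) λ i → ⊨⋀⁺ (interval (LB u i + 1ℤ) (UB u i)) λ m →
          from ⊨⇒ (λ gm → from ⊨g⇔≤ (ℤ.≤-trans (ℤ.<⇒≤ (i≤j⇒i-1<j ℤ.≤-refl)) (to ⊨g⇔≤ gm))))
      , from ⊨∧
      ( (⊨⋀⁺ vertices λ u → ⊨⋀⁺ (indices u) λ i → from ⊨g⇔≤ (LB≤colour u i))
      , from ⊨∧
      ( (⊨⋀⁺ vertices λ u → ⊨⋀⁺ (indices u) λ i → ⊨⋀⁺ (indices u) λ i⁺ →
          ⊨when⁺ (toℕ i⁺ ℕ.≟ ℕ.suc (toℕ i)) λ i⁺≡1+i → ⊨⋀⁺ (interval (LB u i) (UB u i)) λ m →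
          from ⊨⇒ (λ gm → from ⊨g⇔≤ (ℤ.≤-trans
            (ℤ.+-monoˡ-≤ (loop u) (to ⊨g⇔≤ gm)) (+≤+ (spaced u i⁺≡1+i)))))
      , (⊨⋀⁺ vertices λ u → ⊨⋀⁺ vertices λ v →
          ⊨when⁺ (¬? (u Fin.≟ v) ×-dec (u ~? v)) λ (u≢v , e) →
          ⊨⋀⁺ (indices u) λ i → ⊨⋀⁺ (indices v) λ j → ⊨⋀⁺ (interval (LB u i) (UB u i)) λ m →
          from ⊨⇒ (λ xm → from ⊨∨ (Sum.map
            (λ above → from ⊨g⇔≤ (subst (λ m → m + dist e ≤ _) (sym (to ⊨x⇔≡ xm)) (+≤+ above)))
            -- If `g` held at `m - dist e + 1ℤ`, the colour of `u` would be less than `dist e` above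
            -- that of `v`, contradicting `below`.
            (λ below → from ⊨¬ (λ gm → ℤ.<⇒≱ (i-k+1≤j⇒i<j+k (dist e) (to ⊨g⇔≤ gm))
              (subst (_ ≤_) (sym (to ⊨x⇔≡ xm)) (+≤+ below))))
            (inter e u≢v i j))))
      )))))

theorem2 : (I : BMCP) (k : ℤ⁺) →
    (∃[ c ] IsValid I c × HasSpan I c k) ⇔ Satisfiable (OrderBased.formula I k)
theorem2 I k = mk⇔
  (λ (_ , valid , span) → let A = colouring⇒arrangement I valid span in
    assignment I k A , to T-≡ (truth (arrangement⇒satisfied I k A)))
  (λ (_ , sat) → arrangement⇒colouring I (satisfied⇒arrangement I k (holds (from T-≡ sat))))
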